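{- Let $G_1$ and $G_2$ be disjoint cubic graphs with $4$-total colorings $\mathcal{C}_1$ and $\mathcal{C}_2$, respectively, over the color set $\{1,2,3,4\}$, and let $u_1v_1 \in E(G_1)$ and $u_2v_2 \in E(G_2)$. Then there exists a permutation $\pi$ of $\{1,2,3,4\}$ such that \[ \pi\bigl(\mathcal{C}_2(u_2v_2)\bigr) = \mathcal{C}_1(u_1v_1), \qquad \pi\bigl(\mathcal{C}_2(u_2)\bigr) \neq \mathcal{C}_1(u_1), \qquad \pi\bigl(\mathcal{C}_2(v_2)\bigr) \neq \mathcal{C}_1(v_1). \] For every such $\pi$, the graph \[ G_1 \oplus G_2 \;=\; \bigl(G_1 \cup G_2\bigr) - \{u_1v_1,\, u_2v_2\} + \{u_1u_2,\, v_1v_2\} \] (obtained from the disjoint union by deleting the edges $u_1v_1,u_2v_2$ and adding the edges $u_1u_2,v_1v_2$) is a simple cubic graph, connected whenever $G_1$ and $G_2$ are connected and at least one of $u_1v_1$, $u_2v_2$ is not a bridge (of $G_1$, respectively $G_2$), and the assignment $\mathcal{C}$ that coincides with $\mathcal{C}_1$ on the remaining elements of $G_1$, with $\pi \circ \mathcal{C}_2$ on the remaining elements of $G_2$, and that assigns the color $\mathcal{C}_1(u_1v_1)$ to both new edges $u_1u_2$ and $v_1v_2$, is a $4$-total coloring of $G_1 \oplus G_2$. Moreover, for each color $i$, the class of color $i$ in $\mathcal{C}$ has cardinality equal to the sum of the cardinalities of the class of color $i$ in $\mathcal{C}_1$ and of the class of color $i$ in $\pi \circ \mathcal{C}_2$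.
   Context: All graphs are finite, simple and cubic ($3$-regular), not necessarily connected unless stated. The elements of a graph are its vertices and edges. A $4$-total coloring of $G$ assigns one of the four colors $1,2,3,4$ to each vertex and each edge of $G$ so that adjacent vertices receive distinct colors, adjacent edges (edges sharing an endpoint) receive distinct colors, and every vertex and edge that are incident receive distinct colors. The class of color $i$ is the set of all elements of color $i$. -}

module Defs where

open import Data.Empty using (⊥-elim-irr)
open import Data.Fin using (Fin)
import Data.Fin.Properties as Fin
open import Data.Fin.Permutation using (Permutation′; _⟨$⟩ʳ_)
open import Data.Irrelevant using ([_])
open import Data.List using (List; []; _∷_; _++_; map; filter; length; allFin; lookup)
import Data.List.Membership.DecPropositional as DecMembership
open import Data.List.Membership.Propositional using (_∈_; _∉_)
open import Data.List.Membership.Propositional.Properties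
  using (∈-map⁺; ∈-map⁻; ∈-++⁺ˡ; ∈-++⁺ʳ; ∈-allFin)
open import Data.List.Relation.Unary.All using (All; []; _∷_)
open import Data.List.Relation.Unary.AllPairs using ([]; _∷_)
open import Data.List.Relation.Unary.Any using (here; there)
open import Data.List.Relation.Unary.Unique.Propositional using (Unique)
import Data.List.Relation.Unary.Unique.Propositional.Properties as Unique
open import Data.Nat using (ℕ)
open import Data.Product using (_×_; _,_; ∃-syntax; proj₁; proj₂)
import Data.Product as Product
open import Data.Refinement using (Refinement-syntax; _,_; value)
import Data.Refinement.Properties as Refinement
open import Data.Sum using (_⊎_; inj₁; inj₂)
import Data.Sum.Properties as Sum
open import Function using (_∘_)
open import Level using (0ℓ)
open import Relation.Binary.Construct.Closure.ReflexiveTransitive using (Star)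
open import Relation.Binary.Definitions using (DecidableEquality)
open import Relation.Binary.PropositionalEquality using (_≡_; _≢_; refl; cong)
open import Relation.Nullary using (¬_; yes; no; ¬?)
open import Relation.Nullary.Decidable using (_⊎-dec_)
open import Relation.Unary using (Pred; Decidable)

record Finite (A : Set) : Set where
  field
    _≟_      : DecidableEquality A
    elements : List A
    complete : ∀ x → x ∈ elements
    unique   : Unique elements

  -- The cardinality of { x | P x }; since `elements` lists every member of A
  -- exactly once, it does not depend on the chosen enumeration.
  card : {P : Pred A 0ℓ} → Decidable P → ℕ
  card P? = length (filter P? elements)

open Finite

Fin-finite : ∀ n → Finite (Fin n)
Fin-finite n = record
  { _≟_      = Fin._≟_
  ; elements = allFin n
  ; complete = ∈-allFin
  ; unique   = Unique.allFin⁺ n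
  }

infixr 1 _⊎-finite_

_⊎-finite_ : {A B : Set} → Finite A → Finite B → Finite (A ⊎ B)
_⊎-finite_ {A} {B} FA FB = record
  { _≟_      = Sum.≡-dec (_≟_ FA) (_≟_ FB)
  ; elements = map inj₁ (elements FA) ++ map inj₂ (elements FB)
  ; complete = complete′
  ; unique   = Unique.++⁺ (Unique.map⁺ Sum.inj₁-injective (unique FA))
                          (Unique.map⁺ Sum.inj₂-injective (unique FB))
                          disjoint
  }
  where
  complete′ : ∀ x → x ∈ map inj₁ (elements FA) ++ map inj₂ (elements FB)
  complete′ (inj₁ a) = ∈-++⁺ˡ (∈-map⁺ inj₁ (complete FA a))
  complete′ (inj₂ b) = ∈-++⁺ʳ _ (∈-map⁺ inj₂ (complete FB b))

  disjoint : ∀ {x} → ¬ (x ∈ map inj₁ (elements FA) × x ∈ map inj₂ (elements FB))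
  disjoint (p , q) with ∈-map⁻ inj₁ p | ∈-map⁻ inj₂ q
  ... | _ , _ , refl | _ , _ , ()

module _ {A : Set} {P : Pred A 0ℓ} (P? : Decidable P) where

  restrict : List A → List [ x ∈ A ∣ P x ]
  restrict []       = []
  restrict (x ∷ xs) with P? x
  ... | yes p = (x , [ p ]) ∷ restrict xs
  ... | no  _ = restrict xs

  private
    restrict-complete : ∀ {xs} (y : [ x ∈ A ∣ P x ]) → value y ∈ xs → y ∈ restrict xs
    restrict-complete {x ∷ xs} y (here eq) with P? x
    ... | yes _ = here (Refinement.value-injective eq)
    restrict-complete {x ∷ xs} (_ , [ p ]) (here refl) | no ¬p = ⊥-elim-irr (¬p p)
    restrict-complete {x ∷ xs} y (there y∈xs) with P? x
    ... | yes _ = there (restrict-complete y y∈xs)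
    ... | no  _ = restrict-complete y y∈xs

    restrict-fresh : ∀ {y : [ x ∈ A ∣ P x ]} {xs} →
                     All (value y ≢_) xs → All (y ≢_) (restrict xs)
    restrict-fresh {xs = []}     []       = []
    restrict-fresh {xs = x ∷ xs} (≢x ∷ h) with P? x
    ... | yes _ = (≢x ∘ cong value) ∷ restrict-fresh h
    ... | no  _ = restrict-fresh h

    restrict-unique : ∀ {xs} → Unique xs → Unique (restrict xs)
    restrict-unique {[]}     []      = []
    restrict-unique {x ∷ xs} (h ∷ u) with P? x
    ... | yes _ = restrict-fresh h ∷ restrict-unique u
    ... | no  _ = restrict-unique u

  refinement-finite : Finite A → Finite [ x ∈ A ∣ P x ]
  refinement-finite F = record
    { _≟_      = Refinement._≟_ (_≟_ F)
    ; elements = restrict (elements F)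
    ; complete = λ y → restrict-complete y (complete F (value y))
    ; unique   = restrict-unique (unique F)
    }

-- A finite graph given by its vertices, its edges and the two ends of every
-- edge.  The order in which `ends` lists the ends carries no meaning.  Loops and
-- parallel edges are excluded by `IsSimple` rather than by the data, so that
-- adding an edge is always possible and simplicity of the result is a genuine
-- assertion.
record Graph : Set₁ where
  field
    V        : Set
    E        : Set
    ends     : E → V × V
    V-finite : Finite V
    E-finite : Finite E

open Graph

module _ (G : Graph) where

  Joins : E G → V G → V G → Set
  Joins e x y = ends G e ≡ (x , y) ⊎ ends G e ≡ (y , x)

  Adjacent : V G → V G → Set
  Adjacent x y = ∃[ e ] Joins e x y

  Incident : V G → E G → Set
  Incident x e = x ≡ proj₁ (ends G e) ⊎ x ≡ proj₂ (ends G e)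

  incident? : ∀ x → Decidable (Incident x)
  incident? x e = (_≟_ (V-finite G) x (proj₁ (ends G e)))
           ⊎-dec (_≟_ (V-finite G) x (proj₂ (ends G e)))

  -- A loop would be counted once here; degrees are only used for simple graphs.
  degree : V G → ℕ
  degree x = card (E-finite G) (incident? x)

  record IsSimple : Set where
    field
      no-loops     : ∀ x → ¬ Adjacent x x
      no-parallels : ∀ {e f x y} → Joins e x y → Joins f x y → e ≡ f

  record IsSimpleCubic : Set where
    field
      simple  : IsSimple
      regular : ∀ x → degree x ≡ 3

  Reachable : V G → V G → Set
  Reachable = Star Adjacent

  Connected : Set
  Connected = ∀ x y → Reachable x y

infixl 6 _∪_ _─_ _✚_

_∪_ : Graph → Graph → Graph
G ∪ H = record
  { V        = V G ⊎ V H
  ; E        = E G ⊎ E H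
  ; ends     = λ where
      (inj₁ e) → Product.map inj₁ inj₁ (ends G e)
      (inj₂ e) → Product.map inj₂ inj₂ (ends H e)
  ; V-finite = V-finite G ⊎-finite V-finite H
  ; E-finite = E-finite G ⊎-finite E-finite H
  }

_─_ : (G : Graph) → List (E G) → Graph
G ─ es = record
  { V        = V G
  ; E        = [ e ∈ E G ∣ e ∉ es ]
  ; ends     = ends G ∘ value
  ; V-finite = V-finite G
  ; E-finite = refinement-finite (λ e → ¬? (e ∈? es)) (E-finite G)
  }
  where open DecMembership (_≟_ (E-finite G)) using (_∈?_)

_✚_ : (G : Graph) → List (V G × V G) → Graph
G ✚ ps = record
  { V        = V G
  ; E        = E G ⊎ Fin (length ps)
  ; ends     = λ where
      (inj₁ e) → ends G e
      (inj₂ i) → lookup ps i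
  ; V-finite = V-finite G
  ; E-finite = E-finite G ⊎-finite Fin-finite (length ps)
  }

-- A bridge is an edge that separates its ends.
IsBridge : (G : Graph) → E G → Set
IsBridge G e = ¬ Reachable (G ─ (e ∷ [])) (proj₁ (ends G e)) (proj₂ (ends G e))

Color : Set
Color = Fin 4

Element : Graph → Set
Element G = V G ⊎ E G

pattern vertex x = inj₁ x
pattern edge   e = inj₂ e

Coloring : Graph → Set
Coloring G = Element G → Color

record IsTotalColoring (G : Graph) (C : Coloring G) : Set where
  field
    vertex-vertex : ∀ {x y} → Adjacent G x y → C (vertex x) ≢ C (vertex y)
    edge-edge     : ∀ {e f x} → e ≢ f → Incident G x e → Incident G x f →
                    C (edge e) ≢ C (edge f)
    vertex-edge   : ∀ {x e} → Incident G x e → C (vertex x) ≢ C (edge e)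

classCard : (G : Graph) → Coloring G → Color → ℕ
classCard G C i = card (V-finite G ⊎-finite E-finite G) (λ a → C a Fin.≟ i)

-- Used with eᵢ an edge of Gᵢ joining uᵢ and vᵢ.
module _ (G₁ : Graph) (e₁ : E G₁) (u₁ v₁ : V G₁)
         (G₂ : Graph) (e₂ : E G₂) (u₂ v₂ : V G₂) where

  edgeSum : Graph
  edgeSum = (G₁ ∪ G₂) ─ (inj₁ e₁ ∷ inj₂ e₂ ∷ [])
                      ✚ ((inj₁ u₁ , inj₂ u₂) ∷ (inj₁ v₁ , inj₂ v₂) ∷ [])

  edgeSumColoring : Coloring G₁ → Coloring G₂ → Permutation′ 4 → Coloring edgeSum
  edgeSumColoring C₁ C₂ π (vertex (inj₁ x))            = C₁ (vertex x)
  edgeSumColoring C₁ C₂ π (vertex (inj₂ x))            = π ⟨$⟩ʳ C₂ (vertex x)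
  edgeSumColoring C₁ C₂ π (edge (inj₁ (inj₁ e , _)))   = C₁ (edge e)
  edgeSumColoring C₁ C₂ π (edge (inj₁ (inj₂ e , _)))   = π ⟨$⟩ʳ C₂ (edge e)
  edgeSumColoring C₁ C₂ π (edge (inj₂ _))              = C₁ (edge e₁)

  record Compatible (C₁ : Coloring G₁) (C₂ : Coloring G₂) (π : Permutation′ 4) : Set where
    field
      edges-agree : π ⟨$⟩ʳ C₂ (edge e₂)   ≡ C₁ (edge e₁)
      u-differ    : π ⟨$⟩ʳ C₂ (vertex u₂) ≢ C₁ (vertex u₁)
      v-differ    : π ⟨$⟩ʳ C₂ (vertex v₂) ≢ C₁ (vertex v₁)

{-# OPTIONS --safe #-}

-- At every vertex, the new edge takes over the role of the deleted one: both
-- carry the color 𝒞₁(u₁v₁) = π(𝒞₂(u₂v₂)), so degrees and the coloring conditions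
-- at a vertex are inherited from G₁ or G₂, and the only new condition is that
-- the ends of the new edges differ in color.  Two deleted edges are replaced by
-- two new ones of the same color, so the classes keep their sizes.  If, say,
-- u₁v₁ is not a bridge, then u₁ and v₁ stay linked within G₁, hence u₂ and v₂ are
-- linked through u₂u₁ and v₁v₂; so both deleted edges can be bypassed.
module Submission where

open import Defs
open import Data.Bool using (Bool; true; false; if_then_else_)
open import Data.Empty using (⊥-elim-irr)
open import Data.Fin using (Fin; zero; suc)
import Data.Fin.Properties as Fin
open import Data.Fin.Permutation using (Permutation′; _⟨$⟩ʳ_; _⟨$⟩ˡ_; _∘ₚ_; transpose)
import Data.Fin.Permutation as Perm
open import Data.Irrelevant using ([_])
open import Data.List using (List; []; _∷_; _++_; map; filter; length; allFin)
open import Data.List.Membership.Propositional using (_∈_; _∉_)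
open import Data.List.Membership.Propositional.Properties
  using (∈-map⁻; ∈-map⁺; ∈-++⁺ˡ; ∈-++⁺ʳ)
open import Data.List.Membership.Propositional.Properties.WithK using (unique∧set⇒bag)
open import Data.List.Properties
  using (length-++; filter-++; filter-≐; filter-none)
open import Data.List.Relation.Binary.BagAndSetEquality using (∼bag⇒↭)
open import Data.List.Relation.Binary.Permutation.Propositional using (_↭_)
open import Data.List.Relation.Binary.Permutation.Propositional.Properties
  using (filter-↭; ↭-length)
open import Data.List.Relation.Unary.All using ([]; _∷_)
import Data.List.Relation.Unary.All as All
open import Data.List.Relation.Unary.AllPairs using ([]; _∷_)
open import Data.List.Relation.Unary.Any using (here; there)
open import Data.List.Relation.Unary.Unique.Propositional using (Unique)
import Data.List.Relation.Unary.Unique.Propositional.Properties as Unique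
open import Data.Nat using (ℕ; _+_)
open import Data.Nat.Properties using (+-commutativeSemigroup; +-identityʳ)
open import Data.Product using (_×_; _,_; ∃-syntax; ∃₂; proj₁; proj₂)
import Data.Product as Product
open import Data.Refinement using (Refinement-syntax; _,_; value)
import Data.Refinement.Properties as Refinement
open import Data.Sum using (_⊎_; inj₁; inj₂; [_,_]′)
import Data.Sum as Sum
open import Data.Sum.Properties using (inj₁-injective; inj₂-injective)
open import Function using (_∘_; id; mk⇔)
open import Level using (0ℓ)
open import Relation.Binary.Construct.Closure.ReflexiveTransitive
  using (ε; _◅_; _◅◅_; kleisliStar; reverse)
open import Relation.Binary.PropositionalEquality
  using (_≡_; _≢_; refl; sym; trans; cong; cong₂; module ≡-Reasoning)
open import Relation.Nullary using (¬_; Dec; does; yes; no; contradiction)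
open import Relation.Nullary.Decidable using (_×-dec_; _⊎-dec_; decidable-stable; map′)
open import Relation.Unary using (Pred; Decidable; _≐_)
open Graph using (V; E; ends; V-finite; E-finite)
open Finite

-- Counting

count-map : {A B : Set} (f : A → B) {P : Pred B 0ℓ} (P? : Decidable P) (xs : List A) →
            length (filter P? (map f xs)) ≡ length (filter (P? ∘ f) xs)
count-map f P? []       = refl
count-map f P? (x ∷ xs) with P? (f x)
... | yes _ = cong (1 +_) (count-map f P? xs)
... | no  _ = count-map f P? xs

count-++ : {A : Set} {P : Pred A 0ℓ} (P? : Decidable P) (xs ys : List A) →
           length (filter P? (xs ++ ys)) ≡ length (filter P? xs) + length (filter P? ys)
count-++ P? xs ys = trans (cong length (filter-++ P? xs ys)) (length-++ (filter P? xs))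

card-⊎ : {A B : Set} (FA : Finite A) (FB : Finite B) {P : Pred (A ⊎ B) 0ℓ} (P? : Decidable P) →
         card (FA ⊎-finite FB) P? ≡ card FA (P? ∘ inj₁) + card FB (P? ∘ inj₂)
card-⊎ FA FB P? = trans
  (count-++ P? (map inj₁ (elements FA)) (map inj₂ (elements FB)))
  (cong₂ _+_ (count-map inj₁ P? (elements FA)) (count-map inj₂ P? (elements FB)))

card-≐ : {A : Set} (F : Finite A) {P Q : Pred A 0ℓ} (P? : Decidable P) (Q? : Decidable Q) →
         P ≐ Q → card F P? ≡ card F Q?
card-≐ F P? Q? P≐Q = cong length (filter-≐ P? Q? P≐Q (elements F))

card-none : {A : Set} (F : Finite A) {P : Pred A 0ℓ} (P? : Decidable P) →
            (∀ x → ¬ P x) → card F P? ≡ 0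
card-none F P? none = cong length (filter-none P? (All.universal none (elements F)))

-- The enumeration of `F` and the retained elements followed by `es` are both free of repetitions
-- and have the same members, hence are permutations of one another, and `filter` respects
-- permutations.
card-without : {A : Set} (F : Finite A) {es : List A} → Unique es →
               (∉? : Decidable (_∉ es)) {P : Pred A 0ℓ} (P? : Decidable P) →
               card F P? ≡ card (refinement-finite ∉? F) (P? ∘ value) + length (filter P? es)
card-without {A} F {es} es-unique ∉? P? = begin
  length (filter P? (elements F))
    ≡⟨ ↭-length (filter-↭ P? split) ⟩
  length (filter P? (map value rest ++ es))
    ≡⟨ count-++ P? (map value rest) es ⟩
  length (filter P? (map value rest)) + length (filter P? es)
    ≡⟨ cong (_+ _) (count-map value P? rest) ⟩
  length (filter (P? ∘ value) rest) + length (filter P? es)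
    ∎
  where
  open ≡-Reasoning

  R : Finite [ x ∈ A ∣ x ∉ es ]
  R = refinement-finite ∉? F

  rest : List [ x ∈ A ∣ x ∉ es ]
  rest = elements R

  disjoint : ∀ {x} → ¬ (x ∈ map value rest × x ∈ es)
  disjoint (p , q) with ∈-map⁻ value p
  ... | (_ , [ x∉es ]) , _ , refl = ⊥-elim-irr (x∉es q)

  covered : ∀ x → x ∈ map value rest ++ es
  covered x with ∉? x
  ... | yes x∉es = ∈-++⁺ˡ (∈-map⁺ value (complete R (x , [ x∉es ])))
  ... | no ¬x∉es = ∈-++⁺ʳ _ (decidable-stable (x ∈? es) ¬x∉es)
    where open import Data.List.Membership.DecPropositional (_≟_ F) using (_∈?_)

  split : elements F ↭ map value rest ++ es
  -- Without repetitions, equality as sets is already equality as bags.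
  split = ∼bag⇒↭ (unique∧set⇒bag (unique F)
    (Unique.++⁺ (Unique.map⁺ Refinement.value-injective (unique R)) es-unique disjoint)
    (mk⇔ (λ _ → covered _) (λ _ → complete F _)))

indicator : Bool → ℕ
indicator b = if b then 1 else 0

-- In this form each summand depends on a single decision, so the two can be analysed or rewritten
-- separately.
count-two : {A : Set} {P : Pred A 0ℓ} (P? : Decidable P) (a b : A) →
            length (filter P? (a ∷ b ∷ [])) ≡ indicator (does (P? a)) + indicator (does (P? b))
count-two P? a b with does (P? a)
... | true with does (P? b)
...   | true  = refl
...   | false = refl
count-two P? a b | false with does (P? b)
...   | true  = refl
...   | false = refl

-- By the two exclusions each count is 0 or 1, and it is 1 exactly when one of its alternatives
-- holds; the two implications make these conditions equivalent.
count-pair : {A B : Set} {P : Pred A 0ℓ} (P? : Decidable P) {Q : Pred B 0ℓ} (Q? : Decidable Q)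
             (a b : A) (c d : B) →
             ¬ (P a × P b) → ¬ (Q c × Q d) → (P a ⊎ P b → Q c ⊎ Q d) → (Q c ⊎ Q d → P a ⊎ P b) →
             length (filter P? (a ∷ b ∷ [])) ≡ length (filter Q? (c ∷ d ∷ []))
count-pair P? Q? a b c d ¬P ¬Q to from
  rewrite count-two P? a b | count-two Q? c d with P? a | P? b | Q? c | Q? d
... | yes p | yes q | _     | _     = contradiction (p , q) ¬P
... | _     | _     | yes p | yes q = contradiction (p , q) ¬Q
... | yes _ | no _  | yes _ | no _  = refl
... | yes _ | no _  | no _  | yes _ = refl
... | no _  | yes _ | yes _ | no _  = refl
... | no _  | yes _ | no _  | yes _ = refl
... | no _  | no _  | no _  | no _  = refl
... | yes p | no _  | no ¬r | no ¬s = contradiction (to (inj₁ p)) [ ¬r , ¬s ]′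
... | no _  | yes q | no ¬r | no ¬s = contradiction (to (inj₂ q)) [ ¬r , ¬s ]′
... | no ¬p | no ¬q | yes r | no _  = contradiction (from (inj₁ r)) [ ¬p , ¬q ]′
... | no ¬p | no ¬q | no _  | yes s = contradiction (from (inj₂ s)) [ ¬p , ¬q ]′

-- Reachability

module _ (G : Graph) where

  adjacent-sym : ∀ {x y} → Adjacent G x y → Adjacent G y x
  adjacent-sym (e , j) = e , Sum.swap j

  reachable-sym : ∀ {x y} → Reachable G x y → Reachable G y x
  reachable-sym = reverse adjacent-sym

  -- Reachability using edges from the list only: a walk that uses the first
  -- edge can be shortened to use it exactly once.
  ReachableBy : List (E G) → V G → V G → Set
  ReachableBy []       x y = x ≡ y
  ReachableBy (e ∷ es) x y =
    ReachableBy es x y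
    ⊎ ReachableBy es x (proj₁ (ends G e)) × ReachableBy es (proj₂ (ends G e)) y
    ⊎ ReachableBy es x (proj₂ (ends G e)) × ReachableBy es (proj₁ (ends G e)) y

  reachableBy? : ∀ es x y → Dec (ReachableBy es x y)
  reachableBy? []       x y = _≟_ (V-finite G) x y
  reachableBy? (e ∷ es) x y =
    reachableBy? es x y
    ⊎-dec reachableBy? es x (proj₁ (ends G e)) ×-dec reachableBy? es (proj₂ (ends G e)) y
    ⊎-dec reachableBy? es x (proj₂ (ends G e)) ×-dec reachableBy? es (proj₁ (ends G e)) y

  reachableBy-sound : ∀ es {x y} → ReachableBy es x y → Reachable G x y
  reachableBy-sound []       refl = ε
  reachableBy-sound (e ∷ es) (inj₁ p) = reachableBy-sound es p
  reachableBy-sound (e ∷ es) (inj₂ (inj₁ (p , q))) =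
    reachableBy-sound es p ◅◅ (e , inj₁ refl) ◅ reachableBy-sound es q
  reachableBy-sound (e ∷ es) (inj₂ (inj₂ (p , q))) =
    reachableBy-sound es p ◅◅ (e , inj₂ refl) ◅ reachableBy-sound es q

  reachableBy-refl : ∀ es {x} → ReachableBy es x x
  reachableBy-refl []       = refl
  reachableBy-refl (e ∷ es) = inj₁ (reachableBy-refl es)

  -- The delicate case is a walk that already crosses the head edge when that edge is prepended.
  -- Everything up to the old crossing is dropped: the remainder starts either at `y`, one crossing
  -- away from `x`, or at `x` itself.
  reachableBy-step : ∀ {es e x y z} → e ∈ es → Joins G e x y →
                     ReachableBy es y z → ReachableBy es x z
  reachableBy-step {_ ∷ es} (here refl) (inj₁ refl) (inj₁ p) =
    inj₂ (inj₁ (reachableBy-refl es , p))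
  reachableBy-step {_ ∷ es} (here refl) (inj₁ refl) (inj₂ (inj₁ (_ , q))) =
    inj₂ (inj₁ (reachableBy-refl es , q))
  reachableBy-step          (here refl) (inj₁ refl) (inj₂ (inj₂ (_ , q))) = inj₁ q
  reachableBy-step {_ ∷ es} (here refl) (inj₂ refl) (inj₁ p) =
    inj₂ (inj₂ (reachableBy-refl es , p))
  reachableBy-step          (here refl) (inj₂ refl) (inj₂ (inj₁ (_ , q))) = inj₁ q
  reachableBy-step {_ ∷ es} (here refl) (inj₂ refl) (inj₂ (inj₂ (_ , q))) =
    inj₂ (inj₂ (reachableBy-refl es , q))
  reachableBy-step (there e∈) j (inj₁ p) = inj₁ (reachableBy-step e∈ j p)
  reachableBy-step (there e∈) j (inj₂ r) =
    inj₂ (Sum.map (Product.map₁ (reachableBy-step e∈ j))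
                  (Product.map₁ (reachableBy-step e∈ j)) r)

  reachableBy-complete : ∀ {x y} → Reachable G x y → ReachableBy (elements (E-finite G)) x y
  reachableBy-complete ε = reachableBy-refl _
  reachableBy-complete ((e , j) ◅ p) =
    reachableBy-step (complete (E-finite G) e) j (reachableBy-complete p)

  -- With all edges in the list, the bounded notion captures every walk, and deciding it is a
  -- recursion on the list down to equality of vertices.
  reachable? : ∀ x y → Dec (Reachable G x y)
  reachable? x y =
    map′ (reachableBy-sound _) reachableBy-complete (reachableBy? (elements (E-finite G)) x y)

module _ (G H : Graph) (ι : V G → V H) where

  same-ends : ∀ {e u v x y} → Joins G e u v → Reachable H (ι u) (ι v) →
              Joins G e x y → Reachable H (ι x) (ι y)
  same-ends (inj₁ refl) p (inj₁ refl) = p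
  same-ends (inj₁ refl) p (inj₂ refl) = reachable-sym H p
  same-ends (inj₂ refl) p (inj₁ refl) = reachable-sym H p
  same-ends (inj₂ refl) p (inj₂ refl) = p

module _ (G H : Graph) (e : E G) (ι : V G → V H)
         (keep : ∀ {f x y} → f ≢ e → Joins G f x y → Adjacent H (ι x) (ι y)) where

  reachable-without : ∀ {x y} → Reachable (G ─ (e ∷ [])) x y → Reachable H (ι x) (ι y)
  reachable-without = kleisliStar ι λ where
    ((f , [ f∉ ]) , j) → keep (λ f≡e → ⊥-elim-irr (f∉ (here f≡e))) j ◅ ε

  -- Each use of `e` in a walk is replaced by the detour `p`, reversed if necessary; every other
  -- edge survives by `keep`.
  reachable-bypass : ∀ {u v} → Joins G e u v → Reachable H (ι u) (ι v) →
                     ∀ {x y} → Reachable G x y → Reachable H (ι x) (ι y)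
  reachable-bypass {u} {v} euv p = kleisliStar ι step
    where
    step : ∀ {x y} → Adjacent G x y → Reachable H (ι x) (ι y)
    step (f , j) with _≟_ (E-finite G) f e
    ... | no f≢e = keep f≢e j ◅ ε
    ... | yes refl = same-ends G H ι euv p j

-- Simple graphs

module _ (G : Graph) where

  joins-incidentˡ : ∀ {e x y} → Joins G e x y → Incident G x e
  joins-incidentˡ (inj₁ refl) = inj₁ refl
  joins-incidentˡ (inj₂ refl) = inj₂ refl

  joins-incidentʳ : ∀ {e x y} → Joins G e x y → Incident G y e
  joins-incidentʳ = joins-incidentˡ ∘ Sum.swap

  incident-joins : ∀ {e x y z} → Joins G e x y → Incident G z e → z ≡ x ⊎ z ≡ y
  incident-joins (inj₁ refl) = id
  incident-joins (inj₂ refl) = Sum.swap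

  joins-distinct : IsSimple G → ∀ {e x y} → Joins G e x y → x ≢ y
  joins-distinct simple j refl = IsSimple.no-loops simple _ (_ , j)

-- Colorings

permutation-injective : ∀ {n} (π : Permutation′ n) {i j : Fin n} → π ⟨$⟩ʳ i ≡ π ⟨$⟩ʳ j → i ≡ j
permutation-injective π eq =
  trans (sym (Perm.inverseˡ π)) (trans (cong (π ⟨$⟩ˡ_) eq) (Perm.inverseˡ π))

recolor : {G : Graph} {C : Coloring G} (π : Permutation′ 4) →
          IsTotalColoring G C → IsTotalColoring G ((π ⟨$⟩ʳ_) ∘ C)
recolor π total = record
  { vertex-vertex = λ a → vertex-vertex a ∘ permutation-injective π
  ; edge-edge     = λ e≢f i j → edge-edge e≢f i j ∘ permutation-injective π
  ; vertex-edge   = λ i → vertex-edge i ∘ permutation-injective π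
  }
  where open IsTotalColoring total

-- Follow `π` by the transposition of `π x` and `a`. It fixes every value other than these two, so
-- the image of `z` can change only if `z` is `x` or was already sent to `a`.
redirect : ∀ {n} (π : Permutation′ n) (x a : Fin n) →
           ∃[ ρ ] ρ ⟨$⟩ʳ x ≡ a × (∀ {z} → z ≢ x → π ⟨$⟩ʳ z ≢ a → ρ ⟨$⟩ʳ z ≡ π ⟨$⟩ʳ z)
redirect π x a = π ∘ₚ transpose (π ⟨$⟩ʳ x) a , hit , miss
  where
  hit : (π ∘ₚ transpose (π ⟨$⟩ʳ x) a) ⟨$⟩ʳ x ≡ a
  hit with π ⟨$⟩ʳ x Fin.≟ π ⟨$⟩ʳ x
  ... | yes _ = refl
  ... | no ¬r = contradiction refl ¬r

  miss : ∀ {z} → z ≢ x → π ⟨$⟩ʳ z ≢ a → (π ∘ₚ transpose (π ⟨$⟩ʳ x) a) ⟨$⟩ʳ z ≡ π ⟨$⟩ʳ z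
  miss {z} z≢x z≢a with π ⟨$⟩ʳ z Fin.≟ π ⟨$⟩ʳ x
  ... | yes eq = contradiction (permutation-injective π eq) z≢x
  ... | no _ with π ⟨$⟩ʳ z Fin.≟ a
  ...   | yes eq = contradiction eq z≢a
  ...   | no _   = refl

-- Starting from the identity, the images are corrected one at a time. Distinctness of the sources
-- and of the targets guarantees that a later correction leaves the earlier ones intact.
triple-transitive : ∀ {n} {x y z a b c : Fin n} → x ≢ y → x ≢ z → y ≢ z → a ≢ b → a ≢ c → b ≢ c →
                    ∃[ π ] π ⟨$⟩ʳ x ≡ a × π ⟨$⟩ʳ y ≡ b × π ⟨$⟩ʳ z ≡ c
triple-transitive {_} {x} {y} {z} {a} {b} {c} x≢y x≢z y≢z a≢b a≢c b≢c
  with redirect Perm.id x a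
... | π₁ , x₁ , _ with redirect π₁ y b
... | π₂ , y₂ , keep₂ with redirect π₂ z c
... | π₃ , z₃ , keep₃ =
  π₃ , trans (keep₃ x≢z (a≢c ∘ trans (sym x₂))) x₂
     , trans (keep₃ y≢z (b≢c ∘ trans (sym y₂))) y₂
     , z₃
  where
  x₂ : π₂ ⟨$⟩ʳ x ≡ a
  x₂ = trans (keep₂ x≢y (a≢b ∘ trans (sym x₁))) x₁

-- An edge and its ends carry three distinct colors, which is the input that `triple-transitive`
-- needs on either side.
joins-colors : {G : Graph} {C : Coloring G} → IsTotalColoring G C →
               ∀ {e x y} → Joins G e x y →
               C (edge e) ≢ C (vertex x) × C (edge e) ≢ C (vertex y) × C (vertex x) ≢ C (vertex y)
joins-colors {G} total {e} j =
  vertex-edge (joins-incidentˡ G j) ∘ sym ,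
  vertex-edge (joins-incidentʳ G j) ∘ sym ,
  vertex-vertex (e , j)
  where open IsTotalColoring total

-- The edge sum

module _ (G₁ : Graph) (e₁ : E G₁) (u₁ v₁ : V G₁) (j₁ : Joins G₁ e₁ u₁ v₁)
         (G₂ : Graph) (e₂ : E G₂) (u₂ v₂ : V G₂) (j₂ : Joins G₂ e₂ u₂ v₂) where

  private
    N : Graph
    N = edgeSum G₁ e₁ u₁ v₁ G₂ e₂ u₂ v₂

    old : List (E G₁ ⊎ E G₂)
    old = inj₁ e₁ ∷ inj₂ e₂ ∷ []

  pattern kept₁ e p = inj₁ (inj₁ e , p)
  pattern kept₂ e p = inj₁ (inj₂ e , p)
  pattern newᵤ = inj₂ zero
  pattern newᵥ = inj₂ (suc zero)

  -- Sending 𝒞₂(u₂) to 𝒞₁(v₁) and 𝒞₂(v₂) to 𝒞₁(u₁) keeps the ends apart.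
  compatible-exists : ∀ {C₁ C₂} → IsTotalColoring G₁ C₁ → IsTotalColoring G₂ C₂ →
                      ∃[ π ] Compatible G₁ e₁ u₁ v₁ G₂ e₂ u₂ v₂ C₁ C₂ π
  compatible-exists total₁ total₂ with joins-colors total₁ j₁ | joins-colors total₂ j₂
  ... | e≢u , e≢v , u≢v | e≢u′ , e≢v′ , u≢v′
    with triple-transitive e≢u′ e≢v′ u≢v′ e≢v e≢u (u≢v ∘ sym)
  ... | π , πe , πu , πv = π , record
    { edges-agree = πe
    ; u-differ    = λ eq → u≢v (trans (sym eq) πu)
    ; v-differ    = λ eq → u≢v (trans (sym πv) eq)
    }

  -- Edge counts and degrees in the sum

  -- The sum and the disjoint union share the kept edges and differ by a pair each, new or deleted,
  -- so equal counts on the pairs give equal totals. This serves the degrees, with incidence as the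
  -- property, and the color classes, with having a given color.
  card-edges : {P : Pred (E N) 0ℓ} (P? : Decidable P)
               {Q : Pred (E G₁ ⊎ E G₂) 0ℓ} (Q? : Decidable Q) →
               ((λ e → P (inj₁ e)) ≐ (λ e → Q (value e))) →
               length (filter Q? old) ≡ length (filter (P? ∘ inj₂) (allFin 2)) →
               card (E-finite N) P? ≡ card (E-finite G₁) (Q? ∘ inj₁) + card (E-finite G₂) (Q? ∘ inj₂)
  card-edges P? Q? P≐Q same = begin
    card (E-finite N) P?
      ≡⟨ card-⊎ (E-finite H) (Fin-finite 2) P? ⟩
    card (E-finite H) (P? ∘ inj₁) + length (filter (P? ∘ inj₂) (allFin 2))
      ≡⟨ cong₂ _+_ (card-≐ (E-finite H) (P? ∘ inj₁) (Q? ∘ value) P≐Q) (sym same) ⟩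
    card (E-finite H) (Q? ∘ value) + length (filter Q? old)
      -- The two deleted edges come from different summands, so the list of them has no repetition.
      ≡⟨ card-without (E-finite (G₁ ∪ G₂)) (((λ ()) ∷ []) ∷ [] ∷ []) _ Q? ⟨
    card (E-finite (G₁ ∪ G₂)) Q?
      ≡⟨ card-⊎ (E-finite G₁) (E-finite G₂) Q? ⟩
    card (E-finite G₁) (Q? ∘ inj₁) + card (E-finite G₂) (Q? ∘ inj₂)
      ∎
    where
    open ≡-Reasoning

    H : Graph
    H = (G₁ ∪ G₂) ─ old

  -- On the side of `G₁` the new edges end at `u₁` and `v₁`, so one of them meets `x` exactly when
  -- `e₁` does. Neither `e₂` nor any other edge of `G₂` meets `x`.
  edgeSum-degree₁ : u₁ ≢ v₁ → ∀ x → degree N (inj₁ x) ≡ degree G₁ x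
  edgeSum-degree₁ u≢v x = begin
    degree N (inj₁ x)
      ≡⟨ card-edges (incident? N (inj₁ x)) inc? (id , id) exchange ⟩
    card (E-finite G₁) (inc? ∘ inj₁) + card (E-finite G₂) (inc? ∘ inj₂)
      ≡⟨ cong₂ _+_ (card-≐ (E-finite G₁) (inc? ∘ inj₁) (incident? G₁ x)
                     (Sum.map inj₁-injective inj₁-injective , Sum.map (cong inj₁) (cong inj₁)))
                   (card-none (E-finite G₂) (inc? ∘ inj₂) λ _ → λ { (inj₁ ()) ; (inj₂ ()) }) ⟩
    degree G₁ x + 0
      ≡⟨ +-identityʳ _ ⟩
    degree G₁ x
      ∎
    where
    open ≡-Reasoning

    inc? : Decidable (Incident (G₁ ∪ G₂) (inj₁ x))
    inc? = incident? (G₁ ∪ G₂) (inj₁ x)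

    exchange : length (filter inc? old) ≡ length (filter (incident? N (inj₁ x) ∘ inj₂) (allFin 2))
    exchange = count-pair inc? (incident? N (inj₁ x) ∘ inj₂) (inj₁ e₁) (inj₂ e₂) zero (suc zero)
      (λ { (_ , inj₁ ()) ; (_ , inj₂ ()) })
      -- If both new edges met `x`, then `u₁` and `v₁` would coincide.
      (λ { (inj₁ refl , inj₁ refl) → u≢v refl })
      (λ { (inj₁ p) → Sum.map (inj₁ ∘ cong inj₁) (inj₁ ∘ cong inj₁)
                        (incident-joins G₁ j₁ (Sum.map inj₁-injective inj₁-injective p))
         ; (inj₂ (inj₁ ())) ; (inj₂ (inj₂ ())) })
      (λ { (inj₁ (inj₁ refl)) → inj₁ (Sum.map (cong inj₁) (cong inj₁) (joins-incidentˡ G₁ j₁))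
         ; (inj₂ (inj₁ refl)) → inj₁ (Sum.map (cong inj₁) (cong inj₁) (joins-incidentʳ G₁ j₁)) })

  edgeSum-degree₂ : u₂ ≢ v₂ → ∀ x → degree N (inj₂ x) ≡ degree G₂ x
  edgeSum-degree₂ u≢v x = begin
    degree N (inj₂ x)
      ≡⟨ card-edges (incident? N (inj₂ x)) inc? (id , id) exchange ⟩
    card (E-finite G₁) (inc? ∘ inj₁) + card (E-finite G₂) (inc? ∘ inj₂)
      ≡⟨ cong₂ _+_ (card-none (E-finite G₁) (inc? ∘ inj₁) λ _ → λ { (inj₁ ()) ; (inj₂ ()) })
                   (card-≐ (E-finite G₂) (inc? ∘ inj₂) (incident? G₂ x)
                     (Sum.map inj₂-injective inj₂-injective , Sum.map (cong inj₂) (cong inj₂))) ⟩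
    degree G₂ x
      ∎
    where
    open ≡-Reasoning

    inc? : Decidable (Incident (G₁ ∪ G₂) (inj₂ x))
    inc? = incident? (G₁ ∪ G₂) (inj₂ x)

    exchange : length (filter inc? old) ≡ length (filter (incident? N (inj₂ x) ∘ inj₂) (allFin 2))
    exchange = count-pair inc? (incident? N (inj₂ x) ∘ inj₂) (inj₁ e₁) (inj₂ e₂) zero (suc zero)
      (λ { (inj₁ () , _) ; (inj₂ () , _) })
      (λ { (inj₂ refl , inj₂ refl) → u≢v refl })
      (λ { (inj₂ p) → Sum.map (inj₂ ∘ cong inj₂) (inj₂ ∘ cong inj₂)
                        (incident-joins G₂ j₂ (Sum.map inj₂-injective inj₂-injective p))
         ; (inj₁ (inj₁ ())) ; (inj₁ (inj₂ ())) })
      (λ { (inj₁ (inj₂ refl)) → inj₂ (Sum.map (cong inj₂) (cong inj₂) (joins-incidentˡ G₂ j₂))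
         ; (inj₂ (inj₂ refl)) → inj₂ (Sum.map (cong inj₂) (cong inj₂) (joins-incidentʳ G₂ j₂)) })

  -- Simplicity and regularity

  -- Exposes both ends as vertices of `G₁`, so that matching can rule out the other summand and
  -- return to `G₁`.
  joins-∪₁ : ∀ {e X Y} → Joins (G₁ ∪ G₂) (inj₁ e) X Y →
                ∃₂ λ x y → X ≡ inj₁ x × Y ≡ inj₁ y × Joins G₁ e x y
  joins-∪₁ (inj₁ refl) = _ , _ , refl , refl , inj₁ refl
  joins-∪₁ (inj₂ refl) = _ , _ , refl , refl , inj₂ refl

  joins-∪₂ : ∀ {e X Y} → Joins (G₁ ∪ G₂) (inj₂ e) X Y →
                ∃₂ λ x y → X ≡ inj₂ x × Y ≡ inj₂ y × Joins G₂ e x y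
  joins-∪₂ (inj₁ refl) = _ , _ , refl , refl , inj₁ refl
  joins-∪₂ (inj₂ refl) = _ , _ , refl , refl , inj₂ refl

  -- Kept edges stay within one summand and new edges cross between the two. Parallels are thus
  -- possible only between kept edges of the same graph, where simplicity of that graph applies, or
  -- between the two new edges, which would force `u₁` and `v₁` to coincide.
  edgeSum-simple : IsSimple G₁ → IsSimple G₂ → IsSimple N
  edgeSum-simple s₁ s₂ = record { no-loops = no-loops ; no-parallels = no-parallels }
    where
    no-loops : ∀ x → ¬ Adjacent N x x
    no-loops _ (kept₁ e _ , j) with joins-∪₁ j
    ... | _ , _ , refl , refl , j′ = joins-distinct G₁ s₁ j′ refl
    no-loops _ (kept₂ e _ , j) with joins-∪₂ j
    ... | _ , _ , refl , refl , j′ = joins-distinct G₂ s₂ j′ refl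
    no-loops _ (newᵤ , inj₁ ())
    no-loops _ (newᵤ , inj₂ ())
    no-loops _ (newᵥ , inj₁ ())
    no-loops _ (newᵥ , inj₂ ())

    new-not-parallel : ∀ {x y} → Joins N newᵤ x y → ¬ Joins N newᵥ x y
    new-not-parallel (inj₁ refl) (inj₁ eq) =
      joins-distinct G₁ s₁ j₁ (sym (inj₁-injective (cong proj₁ eq)))
    new-not-parallel (inj₁ refl) (inj₂ ())
    new-not-parallel (inj₂ refl) (inj₁ ())
    new-not-parallel (inj₂ refl) (inj₂ eq) =
      joins-distinct G₁ s₁ j₁ (sym (inj₁-injective (cong proj₁ eq)))

    no-parallels : ∀ {e f x y} → Joins N e x y → Joins N f x y → e ≡ f
    no-parallels {kept₁ _ _} {kept₁ _ _} j k with joins-∪₁ j | joins-∪₁ k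
    ... | _ , _ , refl , refl , j′ | _ , _ , refl , refl , k′ =
      cong inj₁ (Refinement.value-injective (cong inj₁ (IsSimple.no-parallels s₁ j′ k′)))
    no-parallels {kept₂ _ _} {kept₂ _ _} j k with joins-∪₂ j | joins-∪₂ k
    ... | _ , _ , refl , refl , j′ | _ , _ , refl , refl , k′ =
      cong inj₁ (Refinement.value-injective (cong inj₂ (IsSimple.no-parallels s₂ j′ k′)))
    no-parallels {kept₁ _ _} {kept₂ _ _} j k with joins-∪₁ j | joins-∪₂ k
    ... | _ , _ , refl , _ | _ , _ , () , _
    no-parallels {kept₂ _ _} {kept₁ _ _} j k with joins-∪₂ j | joins-∪₁ k
    ... | _ , _ , refl , _ | _ , _ , () , _
    no-parallels {kept₁ _ _} {newᵤ} j k with joins-∪₁ j | k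
    ... | _ , _ , refl , refl , _ | inj₁ ()
    ... | _ , _ , refl , refl , _ | inj₂ ()
    no-parallels {kept₁ _ _} {newᵥ} j k with joins-∪₁ j | k
    ... | _ , _ , refl , refl , _ | inj₁ ()
    ... | _ , _ , refl , refl , _ | inj₂ ()
    no-parallels {kept₂ _ _} {newᵤ} j k with joins-∪₂ j | k
    ... | _ , _ , refl , refl , _ | inj₁ ()
    ... | _ , _ , refl , refl , _ | inj₂ ()
    no-parallels {kept₂ _ _} {newᵥ} j k with joins-∪₂ j | k
    ... | _ , _ , refl , refl , _ | inj₁ ()
    ... | _ , _ , refl , refl , _ | inj₂ ()
    no-parallels {newᵤ} {kept₁ _ _} j k = sym (no-parallels k j)
    no-parallels {newᵤ} {kept₂ _ _} j k = sym (no-parallels k j)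
    no-parallels {newᵥ} {kept₁ _ _} j k = sym (no-parallels k j)
    no-parallels {newᵥ} {kept₂ _ _} j k = sym (no-parallels k j)
    no-parallels {newᵤ} {newᵤ} _ _ = refl
    no-parallels {newᵥ} {newᵥ} _ _ = refl
    no-parallels {newᵤ} {newᵥ} j k = contradiction k (new-not-parallel j)
    no-parallels {newᵥ} {newᵤ} j k = contradiction j (new-not-parallel k)

  edgeSum-cubic : IsSimpleCubic G₁ → IsSimpleCubic G₂ → IsSimpleCubic N
  edgeSum-cubic c₁ c₂ = record
    { simple  = edgeSum-simple (simple c₁) (simple c₂)
    ; regular = λ where
        (inj₁ x) → trans (edgeSum-degree₁ (joins-distinct G₁ (simple c₁) j₁) x) (regular c₁ x)
        (inj₂ x) → trans (edgeSum-degree₂ (joins-distinct G₂ (simple c₂) j₂) x) (regular c₂ x)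
    }
    where open IsSimpleCubic

  -- Connectedness

  private
    keep₁ : ∀ {f x y} → f ≢ e₁ → Joins G₁ f x y → Adjacent N (inj₁ x) (inj₁ y)
    keep₁ f≢ j = kept₁ _ [ (λ { (here refl) → f≢ refl ; (there (here ())) }) ]
               , Sum.map (cong (Product.map inj₁ inj₁)) (cong (Product.map inj₁ inj₁)) j

    keep₂ : ∀ {f x y} → f ≢ e₂ → Joins G₂ f x y → Adjacent N (inj₂ x) (inj₂ y)
    keep₂ f≢ j = kept₂ _ [ (λ { (here ()) ; (there (here refl)) → f≢ refl }) ]
               , Sum.map (cong (Product.map inj₂ inj₂)) (cong (Product.map inj₂ inj₂)) j

    uu : Adjacent N (inj₁ u₁) (inj₂ u₂)
    uu = newᵤ , inj₁ refl

    vv : Adjacent N (inj₁ v₁) (inj₂ v₂)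
    vv = newᵥ , inj₁ refl

  -- The two detours let all walks of `G₁` and `G₂` survive in the sum, and one new edge, `uu`, then
  -- links the two sides.
  connected-from-bypasses : Connected G₁ → Connected G₂ →
    Reachable N (inj₁ u₁) (inj₁ v₁) → Reachable N (inj₂ u₂) (inj₂ v₂) → Connected N
  connected-from-bypasses c₁ c₂ p₁ p₂ = connected
    where
    within₁ : ∀ x y → Reachable N (inj₁ x) (inj₁ y)
    within₁ x y = reachable-bypass G₁ N e₁ inj₁ keep₁ j₁ p₁ (c₁ x y)

    within₂ : ∀ x y → Reachable N (inj₂ x) (inj₂ y)
    within₂ x y = reachable-bypass G₂ N e₂ inj₂ keep₂ j₂ p₂ (c₂ x y)

    across : ∀ x y → Reachable N (inj₁ x) (inj₂ y)
    across x y = within₁ x u₁ ◅◅ uu ◅ within₂ u₂ y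

    connected : Connected N
    connected (inj₁ x) (inj₁ y) = within₁ x y
    connected (inj₂ x) (inj₂ y) = within₂ x y
    connected (inj₁ x) (inj₂ y) = across x y
    connected (inj₂ x) (inj₁ y) = reachable-sym N (across y x)

  -- Reachability is decidable in a finite graph, so an edge that is not a bridge
  -- comes with an actual path between its ends that avoids it.
  non-bridge-bypass : (G : Graph) (e : E G) {u v : V G} (ι : V G → V N) → Joins G e u v →
    (∀ {f x y} → f ≢ e → Joins G f x y → Adjacent N (ι x) (ι y)) →
    ¬ IsBridge G e → Reachable N (ι u) (ι v)
  non-bridge-bypass G e ι j keep ¬bridge = same-ends G N ι (inj₁ refl)
    (reachable-without G N e ι keep (decidable-stable (reachable? (G ─ (e ∷ [])) _ _) ¬bridge)) j

  edgeSum-connected : Connected G₁ → Connected G₂ → ¬ IsBridge G₁ e₁ ⊎ ¬ IsBridge G₂ e₂ →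
                      Connected N
  edgeSum-connected c₁ c₂ (inj₁ ¬bridge) = connected-from-bypasses c₁ c₂ p₁
    -- The detour for `e₂` runs from `u₂` to `u₁`, along `p₁` to `v₁`, and on to `v₂`.
    (adjacent-sym N uu ◅ p₁ ◅◅ vv ◅ ε)
    where
    p₁ : Reachable N (inj₁ u₁) (inj₁ v₁)
    p₁ = non-bridge-bypass G₁ e₁ inj₁ j₁ keep₁ ¬bridge
  edgeSum-connected c₁ c₂ (inj₂ ¬bridge) = connected-from-bypasses c₁ c₂
    (uu ◅ p₂ ◅◅ adjacent-sym N vv ◅ ε) p₂
    where
    p₂ : Reachable N (inj₂ u₂) (inj₂ v₂)
    p₂ = non-bridge-bypass G₂ e₂ inj₂ j₂ keep₂ ¬bridge

  -- The coloring conditions, pulled back to each summand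

  -- The edge of Gᵢ whose role an edge of the sum plays at the vertices of Gᵢ
  -- (junk, namely eᵢ, for the kept edges of the other graph).
  trace₁ : E N → E G₁
  trace₁ (kept₁ e _) = e
  trace₁ (kept₂ _ _) = e₁
  trace₁ (inj₂ _)    = e₁

  trace₂ : E N → E G₂
  trace₂ (kept₁ _ _) = e₂
  trace₂ (kept₂ e _) = e
  trace₂ (inj₂ _)    = e₂

  -- A new edge meets `G₁` only in `u₁` or `v₁`, both ends of `e₁`. The junk values never arise,
  -- because a kept edge of `G₂` meets no vertex of `G₁`.
  trace₁-incident : ∀ {x} e → Incident N (inj₁ x) e → Incident G₁ x (trace₁ e)
  trace₁-incident (kept₁ _ _) i           = Sum.map inj₁-injective inj₁-injective i
  trace₁-incident (kept₂ _ _) (inj₁ ())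
  trace₁-incident (kept₂ _ _) (inj₂ ())
  trace₁-incident newᵤ        (inj₁ refl) = joins-incidentˡ G₁ j₁
  trace₁-incident newᵥ        (inj₁ refl) = joins-incidentʳ G₁ j₁

  trace₂-incident : ∀ {x} e → Incident N (inj₂ x) e → Incident G₂ x (trace₂ e)
  trace₂-incident (kept₂ _ _) i           = Sum.map inj₂-injective inj₂-injective i
  trace₂-incident (kept₁ _ _) (inj₁ ())
  trace₂-incident (kept₁ _ _) (inj₂ ())
  trace₂-incident newᵤ        (inj₂ refl) = joins-incidentˡ G₂ j₂
  trace₂-incident newᵥ        (inj₂ refl) = joins-incidentʳ G₂ j₂

  -- No kept edge of `G₁` has trace `e₁`, since `e₁` was deleted; and the two new edges, which do
  -- share that trace, meet `G₁` in different vertices.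
  trace₁-injective : u₁ ≢ v₁ → ∀ {x} e f → Incident N (inj₁ x) e → Incident N (inj₁ x) f →
                     trace₁ e ≡ trace₁ f → e ≡ f
  trace₁-injective u≢v (kept₁ _ _) (kept₁ _ _) _ _ refl = refl
  trace₁-injective u≢v (kept₁ _ [ p ]) (inj₂ _) _ _ refl = ⊥-elim-irr (p (here refl))
  trace₁-injective u≢v (inj₂ _) (kept₁ _ [ p ]) _ _ refl = ⊥-elim-irr (p (here refl))
  trace₁-injective u≢v newᵤ newᵤ _ _ _ = refl
  trace₁-injective u≢v newᵥ newᵥ _ _ _ = refl
  trace₁-injective u≢v newᵤ newᵥ (inj₁ refl) (inj₁ refl) _ = contradiction refl u≢v
  trace₁-injective u≢v newᵥ newᵤ (inj₁ refl) (inj₁ refl) _ = contradiction refl u≢v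
  trace₁-injective u≢v (kept₂ _ _) _ (inj₁ ()) _ _
  trace₁-injective u≢v (kept₂ _ _) _ (inj₂ ()) _ _
  trace₁-injective u≢v _ (kept₂ _ _) _ (inj₁ ()) _
  trace₁-injective u≢v _ (kept₂ _ _) _ (inj₂ ()) _

  trace₂-injective : u₂ ≢ v₂ → ∀ {x} e f → Incident N (inj₂ x) e → Incident N (inj₂ x) f →
                     trace₂ e ≡ trace₂ f → e ≡ f
  trace₂-injective u≢v (kept₂ _ _) (kept₂ _ _) _ _ refl = refl
  trace₂-injective u≢v (kept₂ _ [ p ]) (inj₂ _) _ _ refl = ⊥-elim-irr (p (there (here refl)))
  trace₂-injective u≢v (inj₂ _) (kept₂ _ [ p ]) _ _ refl = ⊥-elim-irr (p (there (here refl)))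
  trace₂-injective u≢v newᵤ newᵤ _ _ _ = refl
  trace₂-injective u≢v newᵥ newᵥ _ _ _ = refl
  trace₂-injective u≢v newᵤ newᵥ (inj₂ refl) (inj₂ refl) _ = contradiction refl u≢v
  trace₂-injective u≢v newᵥ newᵤ (inj₂ refl) (inj₂ refl) _ = contradiction refl u≢v
  trace₂-injective u≢v (kept₁ _ _) _ (inj₁ ()) _ _
  trace₂-injective u≢v (kept₁ _ _) _ (inj₂ ()) _ _
  trace₂-injective u≢v _ (kept₁ _ _) _ (inj₁ ()) _
  trace₂-injective u≢v _ (kept₁ _ _) _ (inj₂ ()) _

  module _ (C₁ : Coloring G₁) (C₂ : Coloring G₂) (π : Permutation′ 4)
           (compatible : Compatible G₁ e₁ u₁ v₁ G₂ e₂ u₂ v₂ C₁ C₂ π) where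

    open Compatible compatible

    private
      C : Coloring N
      C = edgeSumColoring G₁ e₁ u₁ v₁ G₂ e₂ u₂ v₂ C₁ C₂ π

      πC₂ : Coloring G₂
      πC₂ = (π ⟨$⟩ʳ_) ∘ C₂

    trace₁-color : ∀ {x} e → Incident N (inj₁ x) e → C (edge e) ≡ C₁ (edge (trace₁ e))
    trace₁-color (kept₁ _ _) _ = refl
    trace₁-color (inj₂ _)    _ = refl
    trace₁-color (kept₂ _ _) (inj₁ ())
    trace₁-color (kept₂ _ _) (inj₂ ())

    -- The new edges are colored by way of `e₁`; `edges-agree` says that from the side of `G₂` this
    -- is also the color of `e₂`.
    trace₂-color : ∀ {x} e → Incident N (inj₂ x) e → C (edge e) ≡ πC₂ (edge (trace₂ e))
    trace₂-color (kept₂ _ _) _ = refl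
    trace₂-color (inj₂ _)    _ = sym edges-agree
    trace₂-color (kept₁ _ _) (inj₁ ())
    trace₂-color (kept₁ _ _) (inj₂ ())

    -- Conditions involving an edge color concern a single vertex, so the traces carry them back to
    -- the graph containing it. Adjacent vertices are new only across `newᵤ` and `newᵥ`, where
    -- `u-differ` and `v-differ` apply.
    edgeSum-total : u₁ ≢ v₁ → u₂ ≢ v₂ → IsTotalColoring G₁ C₁ → IsTotalColoring G₂ C₂ →
                    IsTotalColoring N C
    edgeSum-total u≢v₁ u≢v₂ total₁ total₂ = record
      { vertex-vertex = vertex-vertex
      ; edge-edge     = edge-edge
      ; vertex-edge   = λ {x} {e} → vertex-edge {x} {e}
      }
      where
      module T₁ = IsTotalColoring total₁
      module T₂ = IsTotalColoring (recolor π total₂)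

      vertex-vertex : ∀ {x y} → Adjacent N x y → C (vertex x) ≢ C (vertex y)
      vertex-vertex (kept₁ _ _ , j) with joins-∪₁ j
      ... | _ , _ , refl , refl , j′ = T₁.vertex-vertex (_ , j′)
      vertex-vertex (kept₂ _ _ , j) with joins-∪₂ j
      ... | _ , _ , refl , refl , j′ = T₂.vertex-vertex (_ , j′)
      vertex-vertex (newᵤ , inj₁ refl) = u-differ ∘ sym
      vertex-vertex (newᵤ , inj₂ refl) = u-differ
      vertex-vertex (newᵥ , inj₁ refl) = v-differ ∘ sym
      vertex-vertex (newᵥ , inj₂ refl) = v-differ

      edge-edge : ∀ {e f x} → e ≢ f → Incident N x e → Incident N x f → C (edge e) ≢ C (edge f)
      edge-edge {e} {f} {inj₁ x} e≢f i k eq =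
        T₁.edge-edge (e≢f ∘ trace₁-injective u≢v₁ e f i k) (trace₁-incident e i) (trace₁-incident f k)
          (trans (sym (trace₁-color e i)) (trans eq (trace₁-color f k)))
      edge-edge {e} {f} {inj₂ x} e≢f i k eq =
        T₂.edge-edge (e≢f ∘ trace₂-injective u≢v₂ e f i k) (trace₂-incident e i) (trace₂-incident f k)
          (trans (sym (trace₂-color e i)) (trans eq (trace₂-color f k)))

      vertex-edge : ∀ {x e} → Incident N x e → C (vertex x) ≢ C (edge e)
      vertex-edge {inj₁ x} {e} i eq =
        T₁.vertex-edge (trace₁-incident e i) (trans eq (trace₁-color e i))
      vertex-edge {inj₂ x} {e} i eq =
        T₂.vertex-edge (trace₂-incident e i) (trans eq (trace₂-color e i))

    -- Sizes of the color classes

    edgeSum-classCard : ∀ i → classCard N C i ≡ classCard G₁ C₁ i + classCard G₂ πC₂ i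
    edgeSum-classCard i = begin
      classCard N C i
        ≡⟨ card-⊎ (V-finite N) (E-finite N) has? ⟩
      card (V-finite N) (has? ∘ inj₁) + card (E-finite N) (has? ∘ inj₂)
        ≡⟨ cong₂ _+_ (card-⊎ (V-finite G₁) (V-finite G₂) (has? ∘ inj₁))
                     (card-edges (has? ∘ inj₂) hadE? same-edges same-pair) ⟩
      (card (V-finite G₁) (has₁? ∘ inj₁) + card (V-finite G₂) (has₂? ∘ inj₁))
        + (card (E-finite G₁) (has₁? ∘ inj₂) + card (E-finite G₂) (has₂? ∘ inj₂))
        -- Regroups from vertices against edges to `G₁` against `G₂`.
        ≡⟨ interchange (card (V-finite G₁) (has₁? ∘ inj₁)) _ _ _ ⟩
      (card (V-finite G₁) (has₁? ∘ inj₁) + card (E-finite G₁) (has₁? ∘ inj₂))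
        + (card (V-finite G₂) (has₂? ∘ inj₁) + card (E-finite G₂) (has₂? ∘ inj₂))
        ≡⟨ cong₂ _+_ (card-⊎ (V-finite G₁) (E-finite G₁) has₁?)
                     (card-⊎ (V-finite G₂) (E-finite G₂) has₂?) ⟨
      classCard G₁ C₁ i + classCard G₂ πC₂ i
        ∎
      where
      open ≡-Reasoning
      open import Algebra.Properties.CommutativeSemigroup +-commutativeSemigroup
        using (interchange)

      has? : Decidable (λ a → C a ≡ i)
      has? a = C a Fin.≟ i

      has₁? : Decidable (λ a → C₁ a ≡ i)
      has₁? a = C₁ a Fin.≟ i

      has₂? : Decidable (λ a → πC₂ a ≡ i)
      has₂? a = πC₂ a Fin.≟ i

      -- The edge coloring of the disjoint union before the exchange, against which `card-edges`
      -- compares the sum.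
      colorE : E G₁ ⊎ E G₂ → Color
      colorE = [ C₁ ∘ inj₂ , πC₂ ∘ inj₂ ]′

      hadE? : Decidable (λ e → colorE e ≡ i)
      hadE? e = colorE e Fin.≟ i

      kept-color : ∀ e → C (edge (inj₁ e)) ≡ colorE (value e)
      kept-color (inj₁ _ , _) = refl
      kept-color (inj₂ _ , _) = refl

      same-edges : (λ e → C (edge (inj₁ e)) ≡ i) ≐ (λ e → colorE (value e) ≡ i)
      same-edges = (λ {e} → trans (sym (kept-color e))) , (λ {e} → trans (kept-color e))

      same-pair : length (filter hadE? old) ≡ length (filter (has? ∘ inj₂ ∘ inj₂) (allFin 2))
      same-pair
        -- Once `edges-agree` is applied, both deleted and both new edges have the color of `e₁`, so
        -- the two sums of indicators are identical.
        rewrite count-two hadE? (inj₁ e₁) (inj₂ e₂)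
              | count-two (has? ∘ inj₂ ∘ inj₂) zero (suc zero)
              | edges-agree
        = refl

lemma6p1 :
    (G₁ G₂ : Graph) → IsSimpleCubic G₁ → IsSimpleCubic G₂ →
    (C₁ : Coloring G₁) (C₂ : Coloring G₂) → IsTotalColoring G₁ C₁ → IsTotalColoring G₂ C₂ →
    (u₁ v₁ : V G₁) (e₁ : E G₁) → Joins G₁ e₁ u₁ v₁ →
    (u₂ v₂ : V G₂) (e₂ : E G₂) → Joins G₂ e₂ u₂ v₂ →
    (∃[ π ] Compatible G₁ e₁ u₁ v₁ G₂ e₂ u₂ v₂ C₁ C₂ π)
    × (∀ (π : Permutation′ 4) → Compatible G₁ e₁ u₁ v₁ G₂ e₂ u₂ v₂ C₁ C₂ π →
       let G = edgeSum G₁ e₁ u₁ v₁ G₂ e₂ u₂ v₂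
           C = edgeSumColoring G₁ e₁ u₁ v₁ G₂ e₂ u₂ v₂ C₁ C₂ π
       in IsSimpleCubic G
          × (Connected G₁ → Connected G₂ → ¬ IsBridge G₁ e₁ ⊎ ¬ IsBridge G₂ e₂ → Connected G)
          × IsTotalColoring G C
          × (∀ i → classCard G C i ≡ classCard G₁ C₁ i + classCard G₂ ((π ⟨$⟩ʳ_) ∘ C₂) i))
lemma6p1 G₁ G₂ cubic₁ cubic₂ C₁ C₂ total₁ total₂ u₁ v₁ e₁ j₁ u₂ v₂ e₂ j₂ =
  compatible-exists G₁ e₁ u₁ v₁ j₁ G₂ e₂ u₂ v₂ j₂ total₁ total₂ ,
  λ π compatible →
    edgeSum-cubic G₁ e₁ u₁ v₁ j₁ G₂ e₂ u₂ v₂ j₂ cubic₁ cubic₂ ,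
    edgeSum-connected G₁ e₁ u₁ v₁ j₁ G₂ e₂ u₂ v₂ j₂ ,
    edgeSum-total G₁ e₁ u₁ v₁ j₁ G₂ e₂ u₂ v₂ j₂ C₁ C₂ π compatible
      (joins-distinct G₁ (IsSimpleCubic.simple cubic₁) j₁)
      (joins-distinct G₂ (IsSimpleCubic.simple cubic₂) j₂) total₁ total₂ ,
    edgeSum-classCard G₁ e₁ u₁ v₁ j₁ G₂ e₂ u₂ v₂ j₂ C₁ C₂ π compatible
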